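{- Let $H$ be a bipartite graph. There exist constants $0<\varepsilon_H\le \frac12$ and $c_H>1$, depending only on $H$, such that for every integer $s\ge 1$ and every positive integer $n$, $\mathrm{ex}(n,K_{s,s},H\text{ -ind})\le c_H s^4 n^{2-\varepsilon_H}$.
   Context: For graphs $F,H$, $\mathrm{ex}(n,F,H\text{ -ind})$ denotes the maximum number of edges of an $n$-vertex graph that contains neither $F$ as a (not necessarily induced) subgraph nor $H$ as an induced subgraph. -}

module Defs where

open import Data.Nat using (ℕ; _<ᵇ_; _≤_; _<_; _*_; _^_; _∸_)
open import Data.Bool using (Bool; true; false; _∧_; if_then_else_)
open import Data.Fin using (Fin; toℕ)
open import Data.List using (List; map; allFin)
open import Data.Nat.ListAction using (sum)
open import Data.Product using (Σ; _×_)
open import Relation.Binary.PropositionalEquality using (_≡_; _≢_)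

record Graph (n : ℕ) : Set where
  field
    adj    : Fin n → Fin n → Bool
    sym    : ∀ i j → adj i j ≡ adj j i
    irrefl : ∀ i → adj i i ≡ false
open Graph public

edges : ∀ {n} → Graph n → ℕ
edges {n} G =
  sum (map (λ i → sum (map (λ j → if (toℕ j <ᵇ toℕ i) ∧ adj G i j then 1 else 0)
                           (allFin n)))
           (allFin n))

IsBipartite : ∀ {h} → Graph h → Set
IsBipartite {h} H = Σ (Fin h → Bool) λ col → ∀ u v → adj H u v ≡ true → col u ≢ col v

ContainsKss : ∀ {n} → ℕ → Graph n → Set
ContainsKss {n} s G =
  Σ (Fin s → Fin n) λ f → Σ (Fin s → Fin n) λ g →
    (∀ i j → f i ≡ f j → i ≡ j) ×
    (∀ i j → g i ≡ g j → i ≡ j) ×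
    (∀ i j → f i ≢ g j) ×
    (∀ i j → adj G (f i) (g j) ≡ true)

ContainsInduced : ∀ {h n} → Graph h → Graph n → Set
ContainsInduced {h} {n} H G =
  Σ (Fin h → Fin n) λ φ →
    (∀ u v → φ u ≡ φ v → u ≡ v) ×
    (∀ u v → adj G (φ u) (φ v) ≡ adj H u v)

{-# OPTIONS --safe #-}
module Submission where

-- Let R ≈ n^(1/q). If the bound fails, then G has at least about n²/R edges, contains no K_{R,R},
-- and every fixed power of R is at most n, once q is large in terms of H.
-- Excluding K_{R,R} makes the complement of G locally dense: for every W with at least R³ vertices,
-- all but R vertices x have at least |W|/R² non-neighbours in W.
-- Dependent random choice gives a large set A whose h-tuples all have many common neighbours. Local
-- density supplies many independent h-tuples in A, and for most tuples x of A it allows any of the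
-- conditions "adjacent to xᵢ" on a common neighbour to be replaced by "non-adjacent to xᵢ" while many
-- vertices still satisfy all conditions. So some independent x realises every adjacency pattern many
-- times; one colour class of H is embedded in x, and the other one, again by local density, in an
-- independent transversal of the sets of vertices realising the patterns prescribed by H.

open import Defs
open import Data.Nat using (ℕ; zero; suc; _+_; _*_; _∸_; _^_; _≤_; _<_; _<ᵇ_; _≤ᵇ_; _≤?_; _<?_; z≤n; s≤s; s≤s⁻¹; z<s; NonZero; >-nonZero)
open import Data.Nat.Properties hiding (_≟_; suc-injective)
open import Data.Nat.Tactic.RingSolver using (solve-∀)
open import Data.Nat.ListAction using (sum)
open import Data.Nat.ListAction.Properties using (sum-++)
open import Data.Bool using (Bool; true; false; _∧_; not; if_then_else_)
open import Data.Bool.Properties using (∧-comm; ∧-identityʳ; ∧-zeroʳ; T-≡)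
open import Data.Fin using (Fin; zero; suc; toℕ; inject≤; _≟_)
open import Data.Fin.Properties using (suc-injective; inject≤-injective)
open import Data.List using (List; []; _∷_; _++_; map; concatMap; allFin; length)
open import Data.List.Properties using (map-++; map-∘; map-tabulate; length-tabulate)
open import Data.List.Membership.Propositional using (_∈_)
open import Data.List.Membership.Propositional.Properties using (∈-allFin; ∈-++⁺ˡ; ∈-++⁺ʳ; ∈-map⁺)
open import Data.List.Relation.Unary.Any using (here; there)
open import Data.Vec using (Vec; []; _∷_; lookup; insertAt; removeAt)
import Data.Vec as Vec
open import Data.Vec.Properties using (insertAt-lookup; removeAt-insertAt; insertAt-removeAt; lookup∘tabulate)
open import Data.Vec.Relation.Unary.All using (All; []; _∷_)
open import Data.Product using (Σ; _×_; _,_; ∃)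
open import Data.Sum using (inj₁; inj₂)
open import Data.Empty using (⊥)
open import Function using (_∘_; Equivalence)
open import Relation.Nullary using (¬_; yes; no; contradiction; ⌊_⌋)
open import Relation.Binary.PropositionalEquality using (_≡_; _≢_; refl; trans; cong; cong₂; subst) renaming (sym to ≡-sym)

-- Finite sums over lists and over lists of tuples

∑ : {A : Set} → List A → (A → ℕ) → ℕ
∑ xs f = sum (map f xs)

⟦_⟧ : Bool → ℕ
⟦ b ⟧ = if b then 1 else 0

module _ {A : Set} where

  ∑-mono : ∀ (xs : List A) {f g : A → ℕ} → (∀ x → f x ≤ g x) → ∑ xs f ≤ ∑ xs g
  ∑-mono []       f≤g = z≤n
  ∑-mono (x ∷ xs) f≤g = +-mono-≤ (f≤g x) (∑-mono xs f≤g)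

  ∑-cong : ∀ (xs : List A) {f g : A → ℕ} → (∀ x → f x ≡ g x) → ∑ xs f ≡ ∑ xs g
  ∑-cong []       f≡g = refl
  ∑-cong (x ∷ xs) f≡g = cong₂ _+_ (f≡g x) (∑-cong xs f≡g)

  ∑-+ : ∀ (xs : List A) (f g : A → ℕ) → ∑ xs (λ x → f x + g x) ≡ ∑ xs f + ∑ xs g
  ∑-+ []       f g = refl
  ∑-+ (x ∷ xs) f g = trans (cong (f x + g x +_) (∑-+ xs f g)) (interchange (f x) (g x) (∑ xs f) (∑ xs g))
    where
    interchange : ∀ a b c d → a + b + (c + d) ≡ a + c + (b + d)
    interchange = solve-∀

  ∑-*ˡ : ∀ (xs : List A) c (f : A → ℕ) → ∑ xs (λ x → c * f x) ≡ c * ∑ xs f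
  ∑-*ˡ []       c f = ≡-sym (*-zeroʳ c)
  ∑-*ˡ (x ∷ xs) c f = trans (cong (c * f x +_) (∑-*ˡ xs c f)) (≡-sym (*-distribˡ-+ c (f x) (∑ xs f)))

  ∑-*ʳ : ∀ (xs : List A) c (f : A → ℕ) → ∑ xs (λ x → f x * c) ≡ ∑ xs f * c
  ∑-*ʳ xs c f = trans (∑-cong xs (λ x → *-comm (f x) c)) (trans (∑-*ˡ xs c f) (*-comm c (∑ xs f)))

  ∑-const : ∀ (xs : List A) c → ∑ xs (λ _ → c) ≡ length xs * c
  ∑-const []       c = refl
  ∑-const (x ∷ xs) c = cong (c +_) (∑-const xs c)

  ∑-++ : ∀ (xs ys : List A) (f : A → ℕ) → ∑ (xs ++ ys) f ≡ ∑ xs f + ∑ ys f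
  ∑-++ xs ys f = trans (cong sum (map-++ f xs ys)) (sum-++ (map f xs) (map f ys))

  -- The averaging argument: each probabilistic choice below is made by comparing two sums over the
  -- whole sample space.
  ∑-<⇒∃< : ∀ (xs : List A) {f g : A → ℕ} → ∑ xs f < ∑ xs g → ∃ λ x → f x < g x
  ∑-<⇒∃< (x ∷ xs) {f} {g} lt with f x <? g x
  ... | yes fx<gx = x , fx<gx
  ... | no  fx≮gx = ∑-<⇒∃< xs (+-cancelˡ-< (f x) _ _ (<-≤-trans lt (+-monoˡ-≤ _ (≮⇒≥ fx≮gx))))

  term≤∑ : ∀ {xs : List A} {x} (f : A → ℕ) → x ∈ xs → f x ≤ ∑ xs f
  term≤∑ f (here refl) = m≤m+n _ _
  term≤∑ f (there x∈)  = ≤-trans (term≤∑ f x∈) (m≤n+m _ _)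

module _ {A : Set} where

  ∑-swap : ∀ {B : Set} (xs : List A) (ys : List B) (f : A → B → ℕ) →
    ∑ xs (λ x → ∑ ys (f x)) ≡ ∑ ys (λ y → ∑ xs (λ x → f x y))
  ∑-swap []       ys f = ≡-sym (trans (∑-const ys 0) (*-zeroʳ (length ys)))
  ∑-swap (x ∷ xs) ys f = trans (cong (∑ ys (f x) +_) (∑-swap xs ys f)) (≡-sym (∑-+ ys (f x) _))

  tuples : List A → ∀ k → List (Vec A k)
  tuples xs zero    = [] ∷ []
  tuples xs (suc k) = concatMap (λ x → map (x ∷_) (tuples xs k)) xs

  ∈-tuples : ∀ {xs : List A} → (∀ x → x ∈ xs) → ∀ {k} (v : Vec A k) → v ∈ tuples xs k
  ∈-tuples {xs} full []      = here refl
  ∈-tuples {xs} full {suc k} (x ∷ v) = go (full x)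
    where
    go : ∀ {ys} → x ∈ ys → (x ∷ v) ∈ concatMap (λ y → map (y ∷_) (tuples xs k)) ys
    go (here refl) = ∈-++⁺ˡ (∈-map⁺ (x ∷_) (∈-tuples full v))
    go (there x∈)  = ∈-++⁺ʳ _ (go x∈)

  ∑-tuples : ∀ (xs : List A) k (F : Vec A (suc k) → ℕ) →
    ∑ (tuples xs (suc k)) F ≡ ∑ xs (λ x → ∑ (tuples xs k) (λ v → F (x ∷ v)))
  ∑-tuples xs k F = go xs
    where
    go : ∀ ys → ∑ (concatMap (λ x → map (x ∷_) (tuples xs k)) ys) F
              ≡ ∑ ys (λ x → ∑ (tuples xs k) (λ v → F (x ∷ v)))
    go []       = refl
    go (y ∷ ys) = trans (∑-++ (map (y ∷_) (tuples xs k)) _ F)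
      (cong₂ _+_ (cong sum (≡-sym (map-∘ (tuples xs k)))) (go ys))

  -- Fubini with an arbitrary coordinate singled out, so that one entry of a tuple can vary while
  -- the others stay fixed.
  ∑-insertAt : ∀ (xs : List A) {k} (i : Fin (suc k)) (F : Vec A (suc k) → ℕ) →
    ∑ (tuples xs (suc k)) F ≡ ∑ xs (λ a → ∑ (tuples xs k) (λ v → F (insertAt v i a)))
  ∑-insertAt xs {k} zero F = ∑-tuples xs k F
  ∑-insertAt xs {suc k} (suc i) F =
    trans (∑-tuples xs (suc k) F)
    (trans (∑-cong xs (λ b → ∑-insertAt xs i (λ v → F (b ∷ v))))
    (trans (∑-swap xs xs _)
           (∑-cong xs (λ a → ≡-sym (∑-tuples xs k (λ v → F (insertAt v (suc i) a)))))))

  all : ∀ {k} → (A → Bool) → Vec A k → Bool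
  all p []      = true
  all p (x ∷ v) = p x ∧ all p v

-- Indicators of Boolean conditions

⟦∧⟧ : ∀ a b → ⟦ a ∧ b ⟧ ≡ ⟦ a ⟧ * ⟦ b ⟧
⟦∧⟧ true  b = ≡-sym (+-identityʳ ⟦ b ⟧)
⟦∧⟧ false b = refl

⟦⟧≤1 : ∀ b → ⟦ b ⟧ ≤ 1
⟦⟧≤1 true  = ≤-refl
⟦⟧≤1 false = z≤n

∧-trueˡ : ∀ {a b} → a ∧ b ≡ true → a ≡ true
∧-trueˡ {true} _ = refl

∧-trueʳ : ∀ {a b} → a ∧ b ≡ true → b ≡ true
∧-trueʳ {true} eq = eq

∧-true : ∀ {a b} → a ≡ true → b ≡ true → a ∧ b ≡ true
∧-true refl refl = refl

∧-left-comm : ∀ a b c → a ∧ (b ∧ c) ≡ b ∧ (a ∧ c)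
∧-left-comm true  b c = refl
∧-left-comm false true  c = refl
∧-left-comm false false c = refl

⟦⟧-mono : ∀ {a b} → (a ≡ true → b ≡ true) → ⟦ a ⟧ ≤ ⟦ b ⟧
⟦⟧-mono {false} f = z≤n
⟦⟧-mono {true}  f rewrite f refl = ≤-refl

⟦⟧<1 : ∀ {b} → ⟦ b ⟧ < 1 → b ≡ false
⟦⟧<1 {false} _ = refl
⟦⟧<1 {true}  (s≤s ())

0<⟦⟧ : ∀ {b} → 0 < ⟦ b ⟧ → b ≡ true
0<⟦⟧ {true} _ = refl

all-insertAt : ∀ {A : Set} {k} (p : A → Bool) (v : Vec A k) i a → all p (insertAt v i a) ≡ p a ∧ all p v
all-insertAt p v       zero    a = refl
all-insertAt p (x ∷ v) (suc i) a = trans (cong (p x ∧_) (all-insertAt p v i a)) (∧-left-comm (p x) (p a) _)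

∑-all : ∀ {A : Set} (xs : List A) (p : A → Bool) k →
  ∑ (tuples xs k) (λ v → ⟦ all p v ⟧) ≡ ∑ xs (λ x → ⟦ p x ⟧) ^ k
∑-all xs p zero    = refl
∑-all xs p (suc k) =
  trans (∑-tuples xs k _)
  (trans (∑-cong xs (λ x → trans (∑-cong (tuples xs k) (λ v → ⟦∧⟧ (p x) (all p v)))
                          (trans (∑-*ˡ (tuples xs k) ⟦ p x ⟧ _) (cong (⟦ p x ⟧ *_) (∑-all xs p k)))))
         (∑-*ʳ xs _ _))

all-true : ∀ {A : Set} {k} (v : Vec A k) → all (λ _ → true) v ≡ true
all-true []      = refl
all-true (_ ∷ v) = all-true v

length-tuples : ∀ {A : Set} (xs : List A) k → length (tuples xs k) ≡ length xs ^ k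
length-tuples xs k =
  trans (≡-sym (trans (∑-const (tuples xs k) 1) (*-identityʳ _)))
  (trans (∑-cong (tuples xs k) (λ v → cong ⟦_⟧ (≡-sym (all-true v))))
  (trans (∑-all xs (λ _ → true) k)
         (cong (_^ k) (trans (∑-const xs 1) (*-identityʳ _)))))

-- Counting vertices

# : ∀ {n} → (Fin n → Bool) → ℕ
# {n} p = ∑ (allFin n) (λ x → ⟦ p x ⟧)

∑-allFin-const : ∀ n c → ∑ (allFin n) (λ _ → c) ≡ n * c
∑-allFin-const n c = trans (∑-const (allFin n) c) (cong (_* c) (length-tabulate {n = n} (λ i → i)))

#≤n : ∀ {n} (p : Fin n → Bool) → # p ≤ n
#≤n {n} p = ≤-trans (∑-mono (allFin n) (λ x → ⟦⟧≤1 (p x))) (≤-reflexive (trans (∑-allFin-const n 1) (*-identityʳ n)))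

∑-allFin-suc : ∀ n (f : Fin (suc n) → ℕ) → ∑ (allFin (suc n)) f ≡ f zero + ∑ (allFin n) (f ∘ suc)
∑-allFin-suc n f = cong (λ ys → f zero + sum ys)
  (trans (map-tabulate suc f) (≡-sym (map-tabulate (λ i → i) (f ∘ suc))))

-- Supplies both sides of the forbidden complete bipartite graph in `few-bad`, where only
-- cardinalities are known.
distinct-witnesses : ∀ {n} (p : Fin n → Bool) k → k ≤ # p →
  Σ (Fin k → Fin n) λ f → (∀ i j → f i ≡ f j → i ≡ j) × (∀ i → p (f i) ≡ true)
distinct-witnesses p zero k≤ = (λ ()) , (λ ()) , (λ ())
distinct-witnesses {suc n} p (suc k) k≤ with p zero in p0 | subst (suc k ≤_) (∑-allFin-suc n (λ x → ⟦ p x ⟧)) k≤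
... | false | le with distinct-witnesses (p ∘ suc) (suc k) le
...   | f , inj , pf = suc ∘ f , (λ i j eq → inj i j (suc-injective eq)) , pf
distinct-witnesses {suc n} p (suc k) k≤ | true | s≤s le with distinct-witnesses (p ∘ suc) k le
...   | f , inj , pf = f′ , inj′ , pf′
  where
  f′ : Fin (suc k) → Fin (suc n)
  f′ zero    = zero
  f′ (suc i) = suc (f i)
  inj′ : ∀ i j → f′ i ≡ f′ j → i ≡ j
  inj′ zero    zero    _  = refl
  inj′ (suc i) (suc j) eq = cong suc (inj i j (suc-injective eq))
  pf′ : ∀ i → p (f′ i) ≡ true
  pf′ zero    = p0
  pf′ (suc i) = pf i

<ᵇ-true : ∀ {m n} → (m <ᵇ n) ≡ true → m < n
<ᵇ-true {m} {n} eq = <ᵇ⇒< m n (Equivalence.from T-≡ eq)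

<ᵇ-false : ∀ {m n} → (m <ᵇ n) ≡ false → n ≤ m
<ᵇ-false {m} {n} eq = ≮⇒≥ λ m<n → contra (trans (≡-sym (Equivalence.to T-≡ (<⇒<ᵇ m<n))) eq)
  where
  contra : true ≢ false
  contra ()

^-distribʳ-* : ∀ m n k → (m * n) ^ k ≡ m ^ k * n ^ k
^-distribʳ-* m n zero    = refl
^-distribʳ-* m n (suc k) = trans (cong (m * n *_) (^-distribʳ-* m n k)) (interchange m n (m ^ k) (n ^ k))
  where
  interchange : ∀ a b c d → a * b * (c * d) ≡ a * c * (b * d)
  interchange = solve-∀

#-eq≤1 : ∀ {n} (x : Fin n) → # (λ w → ⌊ x ≟ w ⌋) ≤ 1
#-eq≤1 x = ≮⇒≥ λ 1<# → two-equal (distinct-witnesses _ 2 1<#)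
  where
  is-x : ∀ {w} → ⌊ x ≟ w ⌋ ≡ true → x ≡ w
  is-x {w} eq with x ≟ w
  ... | yes x≡w = x≡w
  two-equal : (Σ (Fin 2 → Fin _) λ f → (∀ i j → f i ≡ f j → i ≡ j) × (∀ i → ⌊ x ≟ f i ⌋ ≡ true)) → ⊥
  two-equal (f , inj , eq) with inj zero (suc zero) (trans (≡-sym (is-x (eq zero))) (is-x (eq (suc zero))))
  ... | ()

-- Adjacency patterns

-- With `any` at one coordinate, the set of vertices realising a pattern depends only on the other
-- coordinates of the tuple, so the entry at that coordinate can be judged against a fixed set.
data Pat : Set where
  nbr non any : Pat

pats : List Pat
pats = nbr ∷ non ∷ any ∷ []

∈-pats : ∀ p → p ∈ pats
∈-pats nbr = here refl
∈-pats non = there (here refl)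
∈-pats any = there (there (here refl))

nons : ∀ {k} → Vec Pat k → ℕ
nons []        = 0
nons (nbr ∷ π) = nons π
nons (any ∷ π) = nons π
nons (non ∷ π) = suc (nons π)

nons≤ : ∀ {k} (π : Vec Pat k) → nons π ≤ k
nons≤ []        = z≤n
nons≤ (nbr ∷ π) = m≤n⇒m≤1+n (nons≤ π)
nons≤ (any ∷ π) = m≤n⇒m≤1+n (nons≤ π)
nons≤ (non ∷ π) = s≤s (nons≤ π)

-- Rank π c: π arises from a pattern without non by turning c entries any into non, one at a time.
data Rank : ∀ {k} → Vec Pat k → ℕ → Set where
  base : ∀ {k} {π : Vec Pat k} → All (_≢ non) π → Rank π 0
  step : ∀ {k} {π : Vec Pat k} i {c} → Rank (insertAt π i any) c → Rank (insertAt π i non) (suc c)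

Rank-∷ : ∀ {k p} {π : Vec Pat k} {c} → p ≢ non → Rank π c → Rank (p ∷ π) c
Rank-∷ p≢ (base ps) = base (p≢ ∷ ps)
Rank-∷ {p = p} p≢ (step {π = π} i r) = step {π = p ∷ π} (suc i) (Rank-∷ p≢ r)

rank : ∀ {k} (π : Vec Pat k) → Rank π (nons π)
rank []        = base []
rank (nbr ∷ π) = Rank-∷ (λ ()) (rank π)
rank (any ∷ π) = Rank-∷ (λ ()) (rank π)
rank (non ∷ π) = step {π = π} zero (Rank-∷ (λ ()) (rank π))

-- Arithmetic of local density

-- Here `m` is the size of a set `W`, `Y` counts its vertices adjacent to all of `R` bad vertices,
-- and `S` sums the sizes of their non-neighbourhoods in `W`. Then `R * S ≤ m`, so multiplying by
-- `R ≥ 3` gives `3 * m ≤ 2 * R ^ 2 + m`, against `R ^ 3 ≤ m`.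
common-nonneighbours-bound : ∀ R m Y S → 3 ≤ R → m ≤ Y + (S + R) → Y < R → R ^ 2 * S ≤ R * m → R ^ 3 ≤ m → ⊥
common-nonneighbours-bound R m Y S 3≤R m≤ Y<R S≤ R³≤m = <⇒≱ R²<R³ (≤-trans R³≤m m≤R²)
  where
  open ≤-Reasoning
  instance
    R≢0 : NonZero R
    R≢0 = >-nonZero (≤-trans (s≤s z≤n) 3≤R)
  R²<R³ : R ^ 2 < R ^ 3
  R²<R³ = ^-monoʳ-< R (≤-trans (s≤s (s≤s z≤n)) 3≤R) {2} {3} ≤-refl
  RS≤m : R * S ≤ m
  RS≤m = *-cancelˡ-≤ R (≤-trans (≤-reflexive (lem R S)) S≤)
    where
    lem : ∀ a b → a * (a * b) ≡ a * (a * 1) * b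
    lem = solve-∀
  m≤R² : m ≤ R ^ 2
  m≤R² = *-cancelˡ-≤ 2 (+-cancelʳ-≤ m _ _ (begin
    2 * m + m             ≡⟨ e₁ m ⟩
    3 * m                 ≤⟨ *-monoˡ-≤ m 3≤R ⟩
    R * m                 ≤⟨ *-monoʳ-≤ R m≤ ⟩
    R * (Y + (S + R))     ≤⟨ *-monoʳ-≤ R (+-monoˡ-≤ (S + R) (<⇒≤ Y<R)) ⟩
    R * (R + (S + R))     ≡⟨ e₂ R S ⟩
    2 * (R ^ 2) + R * S   ≤⟨ +-monoʳ-≤ (2 * R ^ 2) RS≤m ⟩
    2 * R ^ 2 + m         ∎))
    where
    e₁ : ∀ m → 2 * m + m ≡ 3 * m
    e₁ = solve-∀
    e₂ : ∀ a b → a * (a + (b + a)) ≡ 2 * (a * (a * 1)) + a * b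
    e₂ = solve-∀

-- Since `b ≤ R` and `R ^ 2 ≤ m`, the loss `K * b` is at most a `1 / R` share of `K * m`, hence at
-- most half of it; the other half is bounded by `Z`.
absorb-exceptions : ∀ R m b K Z → 2 ≤ R → R ^ 2 ≤ m → b ≤ R → K * m ≤ Z + K * b → K * m ≤ R * Z
absorb-exceptions R m b K Z 2≤R R²≤m b≤R le = +-cancelʳ-≤ (K * R ^ 2) _ _ (begin
  K * m + K * R ^ 2     ≤⟨ +-monoʳ-≤ (K * m) (*-monoʳ-≤ K R²≤m) ⟩
  K * m + K * m         ≡⟨ e₁ (K * m) ⟩
  2 * (K * m)           ≤⟨ *-monoˡ-≤ (K * m) 2≤R ⟩
  R * (K * m)           ≤⟨ *-monoʳ-≤ R le ⟩
  R * (Z + K * b)       ≤⟨ *-monoʳ-≤ R (+-monoʳ-≤ Z (*-monoʳ-≤ K b≤R)) ⟩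
  R * (Z + K * R)       ≡⟨ e₂ R Z K ⟩
  R * Z + K * R ^ 2     ∎)
  where
  open ≤-Reasoning
  e₁ : ∀ m → m + m ≡ 2 * m
  e₁ = solve-∀
  e₂ : ∀ r z k → r * (z + k * r) ≡ r * z + k * (r * (r * 1))
  e₂ = solve-∀

-- Dependent random choice

deg : ∀ {n} → Graph n → Fin n → ℕ
deg G x = # (adj G x)

common : ∀ {n k} → Graph n → Vec (Fin n) k → Fin n → Bool
common G v z = all (λ x → adj G x z) v

all-swap : ∀ {A B : Set} {k l} (r : A → B → Bool) (v : Vec A k) (w : Vec B l) →
  all (λ a → all (r a) w) v ≡ all (λ b → all (λ a → r a b) v) w
all-swap r []      w = ≡-sym (all-true w)
all-swap r (a ∷ v) w = trans (cong (all (r a) w ∧_) (all-swap r v w)) (≡-sym (all-∧ (r a) _ w))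
  where
  ∧-interchange : ∀ a b c d → (a ∧ b) ∧ (c ∧ d) ≡ (a ∧ c) ∧ (b ∧ d)
  ∧-interchange true  b c d = ∧-left-comm b c d
  ∧-interchange false b c d = refl
  all-∧ : ∀ {A : Set} {k} (p q : A → Bool) (v : Vec A k) → all (λ a → p a ∧ q a) v ≡ all p v ∧ all q v
  all-∧ p q []      = refl
  all-∧ p q (x ∷ v) = trans (cong ((p x ∧ q x) ∧_) (all-∧ p q v)) (∧-interchange (p x) (q x) _ _)

-- A cheap substitute for convexity: `n ^ t * d ≤ d ^ suc t + n ^ suc t`, because the larger of `d`
-- and `n` dominates. The factor 2 in the density hypothesis pays for the additive term.
power-sum : ∀ {n} (G : Graph n) R t → 2 * (n * n) ≤ R * ∑ (allFin n) (deg G) →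
  n * n ^ suc t ≤ R ^ suc t * ∑ (allFin n) (λ x → deg G x ^ suc t)
power-sum {n} G R t dense = +-cancelʳ-≤ (n * n ^ suc t) _ _ (begin
  n * n ^ suc t + n * n ^ suc t           ≡⟨ double n (n ^ t) ⟩
  n ^ t * (2 * (n * n))                   ≤⟨ *-monoʳ-≤ (n ^ t) dense ⟩
  n ^ t * (R * ∑ V (deg G))               ≡⟨ cong (n ^ t *_) (∑-*ˡ V R (deg G)) ⟨
  n ^ t * ∑ V (λ x → R * deg G x)         ≡⟨ ∑-*ˡ V (n ^ t) _ ⟨
  ∑ V (λ x → n ^ t * (R * deg G x))       ≤⟨ ∑-mono V (λ x → tangent (R * deg G x)) ⟩
  ∑ V (λ x → (R * deg G x) ^ suc t + n ^ suc t)
                                          ≡⟨ ∑-+ V _ _ ⟩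
  ∑ V (λ x → (R * deg G x) ^ suc t) + ∑ V (λ _ → n ^ suc t)
                                          ≡⟨ cong₂ _+_ (trans (∑-cong V λ x → ^-distribʳ-* R (deg G x) (suc t)) (∑-*ˡ V (R ^ suc t) _))
                                                       (∑-allFin-const n (n ^ suc t)) ⟩
  R ^ suc t * ∑ V (λ x → deg G x ^ suc t) + n * n ^ suc t ∎)
  where
  open ≤-Reasoning
  V : List (Fin n)
  V = allFin n
  double : ∀ n p → n * (n * p) + n * (n * p) ≡ p * (2 * (n * n))
  double = solve-∀
  tangent : ∀ d → n ^ t * d ≤ d ^ suc t + n ^ suc t
  tangent d with ≤-total d n
  ... | inj₁ d≤n = ≤-trans (*-monoʳ-≤ (n ^ t) d≤n) (≤-trans (≤-reflexive (*-comm (n ^ t) n)) (m≤n+m _ _))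
  ... | inj₂ n≤d = ≤-trans (*-monoˡ-≤ d (^-monoˡ-≤ t n≤d)) (≤-trans (≤-reflexive (*-comm (d ^ t) d)) (m≤m+n _ _))

-- A is the common neighbourhood of t + 1 vertices: averaged over their choice, A is large
-- while it contains less than 1/n bad tuples.
dependent-random-choice : ∀ {n} (G : Graph n) R h t L M → 3 ≤ R → 1 ≤ n →
  2 * (n * n) ≤ R * ∑ (allFin n) (deg G) →
  R * (n * n ^ h * (R * L) ^ suc t) ≤ n * n ^ suc t →
  R * (R ^ suc t * M) ≤ n →
  Σ (Fin n → Bool) λ A → M ≤ # A × (∀ (x : Vec (Fin n) h) → all A x ≡ true → L ≤ # (common G x))
dependent-random-choice {n} G R h t L M 3≤R 1≤n dense few-bad large =
  conclude (∑-<⇒∃< (tuples V k) (*-cancelˡ-< (R ^ k) _ _ cost<gain))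
  where
  open ≤-Reasoning
  V : List (Fin n)
  V = allFin n
  k : ℕ
  k = suc t
  A : Vec (Fin n) k → Fin n → Bool
  A y x = all (adj G x) y
  poor : Vec (Fin n) h → Bool
  poor x = # (common G x) <ᵇ L
  B : Vec (Fin n) k → ℕ
  B y = ∑ (tuples V h) (λ x → ⟦ all (A y) x ∧ poor x ⟧)
  ∑A : ∑ (tuples V k) (λ y → # (A y)) ≡ ∑ V (λ x → deg G x ^ k)
  ∑A = trans (∑-swap (tuples V k) V _) (∑-cong V λ x → ∑-all V (adj G x) k)
  ∑B : ∑ (tuples V k) B ≤ n ^ h * L ^ k
  ∑B = begin
    ∑ (tuples V k) B                              ≡⟨ ∑-swap (tuples V k) (tuples V h) _ ⟩
    ∑ (tuples V h) (λ x → ∑ (tuples V k) (λ y → ⟦ all (A y) x ∧ poor x ⟧))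
                                                  ≤⟨ ∑-mono (tuples V h) per-tuple ⟩
    ∑ (tuples V h) (λ _ → L ^ k)                  ≡⟨ ∑-const (tuples V h) (L ^ k) ⟩
    length (tuples V h) * L ^ k                   ≡⟨ cong (_* L ^ k) (trans (length-tuples V h) (cong (_^ h) (length-tabulate {n = n} (λ i → i)))) ⟩
    n ^ h * L ^ k                                 ∎
    where
    -- A tuple `x` lies in the set of `y` exactly when all of `y` lies in the common neighbourhood
    -- of `x`, so a poor `x` is hit by at most `L ^ k` choices of `y`.
    per-tuple : ∀ x → ∑ (tuples V k) (λ y → ⟦ all (A y) x ∧ poor x ⟧) ≤ L ^ k
    per-tuple x with poor x in px
    ... | true  = begin
      ∑ (tuples V k) (λ y → ⟦ all (A y) x ∧ true ⟧) ≡⟨ ∑-cong (tuples V k) (λ y → cong ⟦_⟧ (trans (∧-identityʳ _) (all-swap (adj G) x y))) ⟩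
      ∑ (tuples V k) (λ y → ⟦ all (common G x) y ⟧) ≡⟨ ∑-all V (common G x) k ⟩
      # (common G x) ^ k                            ≤⟨ ^-monoˡ-≤ k (<⇒≤ (<ᵇ-true {# (common G x)} {L} px)) ⟩
      L ^ k                                         ∎
    ... | false = begin
      ∑ (tuples V k) (λ y → ⟦ all (A y) x ∧ false ⟧) ≡⟨ ∑-cong (tuples V k) (λ y → cong ⟦_⟧ (∧-zeroʳ _)) ⟩
      ∑ (tuples V k) (λ y → 0)                      ≡⟨ trans (∑-const (tuples V k) 0) (*-zeroʳ (length (tuples V k))) ⟩
      0                                             ≤⟨ z≤n ⟩
      L ^ k                                         ∎
  -- Bad tuples get weight `n`: a set has at most `n` elements, so one whose size exceeds the cost
  -- contains no bad tuple and has more than `M` elements.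
  cost : Vec (Fin n) k → ℕ
  cost y = n * B y + M
  ∑cost : R ^ k * ∑ (tuples V k) cost ≤ n * n ^ h * (R * L) ^ k + n ^ k * (R ^ k * M)
  ∑cost = begin
    R ^ k * ∑ (tuples V k) cost                   ≡⟨ cong (R ^ k *_) (trans (∑-+ (tuples V k) _ _)
                                                       (cong₂ _+_ (∑-*ˡ (tuples V k) n B)
                                                         (trans (∑-const (tuples V k) M) (cong (_* M) (trans (length-tuples V k) (cong (_^ k) (length-tabulate {n = n} (λ i → i)))))))) ⟩
    R ^ k * (n * ∑ (tuples V k) B + n ^ k * M)    ≤⟨ *-monoʳ-≤ (R ^ k) (+-monoˡ-≤ _ (*-monoʳ-≤ n ∑B)) ⟩
    R ^ k * (n * (n ^ h * L ^ k) + n ^ k * M)     ≡⟨ rearrange (R ^ k) n (n ^ h) (L ^ k) (n ^ k) M ⟩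
    n * n ^ h * (R ^ k * L ^ k) + n ^ k * (R ^ k * M)
                                                  ≡⟨ cong (λ z → n * n ^ h * z + n ^ k * (R ^ k * M)) (^-distribʳ-* R L k) ⟨
    n * n ^ h * (R * L) ^ k + n ^ k * (R ^ k * M) ∎
    where
    rearrange : ∀ r n a l b m → r * (n * (a * l) + b * m) ≡ n * a * (r * l) + b * (r * m)
    rearrange = solve-∀
  -- After multiplication by `R`, each of the two parts of the cost is at most `n * n ^ k`, and
  -- `2 < R` makes the comparison strict.
  cost<gain : R ^ k * ∑ (tuples V k) cost < R ^ k * ∑ (tuples V k) (λ y → # (A y))
  cost<gain = <-≤-trans (*-cancelˡ-< R _ _ (begin-strict
    R * (R ^ k * ∑ (tuples V k) cost)             ≤⟨ *-monoʳ-≤ R ∑cost ⟩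
    R * (X + n ^ k * (R ^ k * M))                 ≡⟨ distribute R X (n ^ k) (R ^ k * M) ⟩
    R * X + n ^ k * (R * (R ^ k * M))             ≤⟨ +-mono-≤ few-bad (*-monoʳ-≤ (n ^ k) large) ⟩
    n * n ^ k + n ^ k * n                         ≡⟨ double n (n ^ k) ⟩
    2 * (n * n ^ k)                               <⟨ *-monoˡ-< (n * n ^ k) {{n*nᵏ≢0}} 3≤R ⟩
    R * (n * n ^ k)                               ∎))
    (≤-trans (power-sum G R t dense) (≤-reflexive (cong (R ^ k *_) (≡-sym ∑A))))
    where
    X : ℕ
    X = n * n ^ h * (R * L) ^ k
    n*nᵏ≢0 : NonZero (n * n ^ k)
    n*nᵏ≢0 = m^n≢0 n (suc k) {{>-nonZero 1≤n}}
    distribute : ∀ r x a b → r * (x + a * b) ≡ r * x + a * (r * b)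
    distribute = solve-∀
    double : ∀ n a → n * a + a * n ≡ 2 * (n * a)
    double = solve-∀
  rich : ∀ y → cost y < # (A y) → ∀ x → all (A y) x ≡ true → poor x ≡ false
  rich y y-good x x⊆A = ⟦⟧<1 {poor x} (≤-<-trans
    (≤-trans (≤-reflexive (cong (λ b → ⟦ b ∧ poor x ⟧) (≡-sym x⊆A)))
             (term≤∑ (λ x → ⟦ all (A y) x ∧ poor x ⟧) (∈-tuples ∈-allFin x)))
    B<1)
    where
    B<1 : B y < 1
    B<1 = *-cancelˡ-< n _ _ (≤-<-trans (m≤m+n _ M)
      (<-≤-trans y-good (≤-trans (#≤n (A y)) (≤-reflexive (≡-sym (*-identityʳ n))))))
  conclude : (∃ λ y → cost y < # (A y)) →
    Σ (Fin n → Bool) λ A → M ≤ # A × (∀ (x : Vec (Fin n) h) → all A x ≡ true → L ≤ # (common G x))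
  conclude (y , y-good) =
    A y , ≤-trans (m≤n+m M _) (<⇒≤ y-good) , λ x x⊆A → <ᵇ-false {# (common G x)} {L} (rich y y-good x x⊆A)

-- Local density of the complement

module Host {n : ℕ} (G : Graph n) (R : ℕ) (3≤R : 3 ≤ R) (Kss-free : ¬ ContainsKss R G) where

  open ≤-Reasoning

  V : List (Fin n)
  V = allFin n

  1<R : 1 < R
  1<R = ≤-trans (s≤s (s≤s z≤n)) 3≤R

  instance
    R≢0 : NonZero R
    R≢0 = >-nonZero (<-trans z<s 1<R)

  -- Distinctness is built in because no vertex is adjacent to itself; pairwise apart families are
  -- then injective.
  apart : Fin n → Fin n → Bool
  apart x w = not (adj G x w) ∧ not ⌊ x ≟ w ⌋

  apart⇒¬adj : ∀ {x w} → apart x w ≡ true → adj G x w ≡ false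
  apart⇒¬adj {x} {w} eq with adj G x w
  ... | false = refl

  apart⇒≢ : ∀ {x w} → apart x w ≡ true → x ≢ w
  apart⇒≢ {x} {w} eq x≡w with adj G x w | x ≟ w
  ... | false | no x≢w = x≢w x≡w

  adj⇒≢ : ∀ {x w} → adj G x w ≡ true → x ≢ w
  adj⇒≢ {x} eq refl with trans (≡-sym eq) (irrefl G x)
  ... | ()

  apart-sym : ∀ {x w} → apart x w ≡ true → apart w x ≡ true
  apart-sym {x} {w} eq with apart⇒¬adj {x} {w} eq | apart⇒≢ {x} {w} eq
  ... | ¬xw | x≢w rewrite sym G w x | ¬xw with w ≟ x
  ...   | yes w≡x = contradiction (≡-sym w≡x) x≢w
  ...   | no _    = refl

  _∩apart_ : (Fin n → Bool) → Fin n → Fin n → Bool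
  (W ∩apart x) w = W w ∧ apart x w

  bad : (Fin n → Bool) → Fin n → Bool
  bad W x = R ^ 2 * # (W ∩apart x) <ᵇ # W

  ¬bad⇒ : ∀ W x → bad W x ≡ false → # W ≤ R ^ 2 * # (W ∩apart x)
  ¬bad⇒ W x = <ᵇ-false

  -- Together, `R` bad vertices have non-neighbours in at most a `1 / R` share of `W`. Even after
  -- discarding the bad vertices themselves, at least `R` vertices of `W` would be adjacent to all
  -- of them, a copy of `K_{R,R}`.
  few-bad : ∀ W → R ^ 3 ≤ # W → # (bad W) < R
  few-bad W R³≤W = ≰⇒> λ R≤bad → no-bad-family (distinct-witnesses (bad W) R R≤bad)
    where
    no-bad-family : (Σ (Fin R → Fin n) λ f → (∀ i j → f i ≡ f j → i ≡ j) × (∀ i → bad W (f i) ≡ true)) → ⊥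
    no-bad-family (f , f-inj , f-bad) = common-nonneighbours-bound R (# W) (# Y) (∑ (allFin R) c) 3≤R W≤ Y<R S≤ R³≤W
      where
      c : Fin R → ℕ
      c i = # (W ∩apart (f i))
      missed : Fin n → ℕ
      missed w = ∑ (allFin R) (λ i → ⟦ not (adj G (f i) w) ⟧)
      Y : Fin n → Bool
      Y w = W w ∧ (missed w <ᵇ 1)
      Y<R : # Y < R
      Y<R = ≰⇒> λ R≤Y → let (g , g-inj , g∈Y) = distinct-witnesses Y R R≤Y in
        Kss-free (f , g , f-inj , g-inj , (λ i j → adj⇒≢ (edge i j (g∈Y j))) , λ i j → edge i j (g∈Y j))
        where
        not0 : ∀ {b} → ⟦ not b ⟧ < 1 → b ≡ true
        not0 {true} _ = refl
        not0 {false} (s≤s ())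
        edge : ∀ i j {w} → Y w ≡ true → adj G (f i) w ≡ true
        edge i j {w} w∈Y = not0 (≤-<-trans
          (term≤∑ (λ i → ⟦ not (adj G (f i) w) ⟧) (∈-allFin i))
          (<ᵇ-true (∧-trueʳ {W w} w∈Y)))
      S≤ : R ^ 2 * ∑ (allFin R) c ≤ R * # W
      S≤ = begin
        R ^ 2 * ∑ (allFin R) c              ≡⟨ ∑-*ˡ (allFin R) (R ^ 2) c ⟨
        ∑ (allFin R) (λ i → R ^ 2 * c i)    ≤⟨ ∑-mono (allFin R) (λ i → <⇒≤ (<ᵇ-true (f-bad i))) ⟩
        ∑ (allFin R) (λ _ → # W)            ≡⟨ ∑-allFin-const R (# W) ⟩
        R * # W                             ∎
      -- `missed` also counts the case `f i ≡ w`, which `apart` leaves out; the second indicator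
      -- restores it and contributes the extra `R` in `W≤`.
      caught : Fin n → ℕ
      caught w = ∑ (allFin R) (λ i → ⟦ (W ∩apart (f i)) w ⟧ + ⟦ ⌊ f i ≟ w ⌋ ⟧)
      pointwise : ∀ w → ⟦ W w ⟧ ≤ ⟦ Y w ⟧ + caught w
      pointwise w = split (W w) (missed w) (caught w) λ Ww → ∑-mono (allFin R) λ i → one Ww (f i)
        where
        split : ∀ b s t → (b ≡ true → s ≤ t) → ⟦ b ⟧ ≤ ⟦ b ∧ (s <ᵇ 1) ⟧ + t
        split false s       t s≤t = z≤n
        split true  zero    t s≤t = s≤s z≤n
        split true  (suc s) t s≤t = ≤-trans (s≤s z≤n) (s≤t refl)
        one : W w ≡ true → ∀ x → ⟦ not (adj G x w) ⟧ ≤ ⟦ (W ∩apart x) w ⟧ + ⟦ ⌊ x ≟ w ⌋ ⟧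
        one Ww x rewrite Ww with adj G x w | ⌊ x ≟ w ⌋
        ... | true  | _     = z≤n
        ... | false | true  = ≤-refl
        ... | false | false = ≤-refl
      W≤ : # W ≤ # Y + (∑ (allFin R) c + R)
      W≤ = begin
        # W                       ≤⟨ ∑-mono V pointwise ⟩
        ∑ V (λ w → ⟦ Y w ⟧ + caught w)   ≡⟨ ∑-+ V _ caught ⟩
        # Y + ∑ V caught          ≡⟨ cong (# Y +_) (∑-swap V (allFin R) _) ⟩
        # Y + ∑ (allFin R) (λ i → ∑ V (λ w → ⟦ (W ∩apart (f i)) w ⟧ + ⟦ ⌊ f i ≟ w ⌋ ⟧))
                                  ≡⟨ cong (# Y +_) (∑-cong (allFin R) λ i → ∑-+ V _ _) ⟩
        # Y + ∑ (allFin R) (λ i → c i + # (λ w → ⌊ f i ≟ w ⌋))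
                                  ≤⟨ +-monoʳ-≤ (# Y) (∑-mono (allFin R) λ i → +-monoʳ-≤ (c i) (#-eq≤1 (f i))) ⟩
        # Y + ∑ (allFin R) (λ i → c i + 1)
                                  ≡⟨ cong (# Y +_) (∑-+ (allFin R) c _) ⟩
        # Y + (∑ (allFin R) c + ∑ (allFin R) (λ _ → 1))
                                  ≡⟨ cong (λ r → # Y + (∑ (allFin R) c + r)) (trans (∑-allFin-const R 1) (*-identityʳ R)) ⟩
        # Y + (∑ (allFin R) c + R) ∎

  ^-2+ : ∀ a → R ^ (2 + a) ≡ R ^ 2 * R ^ a
  ^-2+ a = ^-distribˡ-+-* R 2 a

  -- Each restriction to the non-neighbours of a vertex that is not bad costs `R ^ 2`. An exponent
  -- `3 + k * 2` thus budgets `k` restrictions and keeps `R ^ 3` for `few-bad`.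
  still-large : ∀ {W x a} → bad W x ≡ false → R ^ (2 + a) ≤ # W → R ^ a ≤ # (W ∩apart x)
  still-large {W} {x} {a} ok le = *-cancelˡ-≤ (R ^ 2) {{m^n≢0 R 2}}
    (≤-trans (≤-reflexive (≡-sym (^-2+ a))) (≤-trans le (¬bad⇒ W x ok)))

  -- Counting independent tuples

  Apart : ∀ {k} → (Fin k → Fin n) → Set
  Apart y = ∀ i j → i ≢ j → apart (y i) (y j) ≡ true

  indep : ∀ {k} → (Fin n → Bool) → Vec (Fin n) k → Bool
  indep C []      = true
  indep C (x ∷ v) = C x ∧ indep (C ∩apart x) v

  #indep : ∀ k → (Fin n → Bool) → ℕ
  #indep k C = ∑ (tuples V k) (λ v → ⟦ indep C v ⟧)

  -- Induction on the first entry: if it is not bad, the candidate set keeps a `1 / R ^ 2` share,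
  -- and the fewer than `R` bad entries are absorbed at the price of one factor `R`. The loss grows
  -- by `R ^ (2 * k + 1)`, which sums to a square in the exponent.
  many-indep : ∀ k C → R ^ (3 + k * 2) ≤ # C → # C ^ k ≤ R ^ (k * k) * #indep k C
  many-indep zero    C le = ≤-refl
  many-indep (suc k) C le = begin
    m ^ suc k                           ≡⟨ *-comm m (m ^ k) ⟩
    m ^ k * m                           ≤⟨ absorb-exceptions R m (# (bad C)) (m ^ k) (E * I) 1<R R²≤m (<⇒≤ (few-bad C R³≤m)) summed ⟩
    R * (E * I)                         ≡⟨ *-assoc R E I ⟨
    R ^ suc (2 * k + k * k) * I         ≡⟨ cong (λ e → R ^ e * I) (exponent k) ⟩
    R ^ (suc k * suc k) * I             ∎
    where
    m E I : ℕ
    m = # C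
    E = R ^ (2 * k + k * k)
    I = #indep (suc k) C
    exponent : ∀ k → 1 + (2 * k + k * k) ≡ (1 + k) * (1 + k)
    exponent = solve-∀
    R²≤m : R ^ 2 ≤ m
    R²≤m = ≤-trans (^-monoʳ-≤ R (m≤m+n 2 (3 + k * 2))) le
    R³≤m : R ^ 3 ≤ m
    R³≤m = ≤-trans (^-monoʳ-≤ R (m≤m+n 3 (2 + k * 2))) le
    pointwise : ∀ x → m ^ k * ⟦ C x ⟧ ≤ E * (⟦ C x ⟧ * #indep k (C ∩apart x)) + m ^ k * ⟦ bad C x ⟧
    pointwise x with C x | bad C x in ok
    ... | false | _     = ≤-trans (≤-reflexive (*-zeroʳ (m ^ k))) z≤n
    ... | true  | true  = m≤n+m _ _
    ... | true  | false = ≤-trans (begin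
      m ^ k * 1                           ≡⟨ *-identityʳ (m ^ k) ⟩
      m ^ k                               ≤⟨ ^-monoˡ-≤ k (¬bad⇒ C x ok) ⟩
      (R ^ 2 * # (C ∩apart x)) ^ k        ≡⟨ ^-distribʳ-* (R ^ 2) _ k ⟩
      (R ^ 2) ^ k * # (C ∩apart x) ^ k    ≡⟨ cong (_* # (C ∩apart x) ^ k) (^-*-assoc R 2 k) ⟩
      R ^ (2 * k) * # (C ∩apart x) ^ k    ≤⟨ *-monoʳ-≤ (R ^ (2 * k)) (many-indep k (C ∩apart x) (still-large {a = 3 + k * 2} ok le)) ⟩
      R ^ (2 * k) * (R ^ (k * k) * J)     ≡⟨ *-assoc (R ^ (2 * k)) _ J ⟨
      R ^ (2 * k) * R ^ (k * k) * J       ≡⟨ cong₂ _*_ (≡-sym (^-distribˡ-+-* R (2 * k) (k * k))) (≡-sym (*-identityˡ J)) ⟩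
      E * (1 * J)                         ∎) (m≤m+n _ _)
      where
      J : ℕ
      J = #indep k (C ∩apart x)
    summed : m ^ k * m ≤ E * I + m ^ k * # (bad C)
    summed = begin
      m ^ k * m                                     ≡⟨ ∑-*ˡ V (m ^ k) _ ⟨
      ∑ V (λ x → m ^ k * ⟦ C x ⟧)                   ≤⟨ ∑-mono V pointwise ⟩
      ∑ V (λ x → E * (⟦ C x ⟧ * #indep k (C ∩apart x)) + m ^ k * ⟦ bad C x ⟧)
                                                    ≡⟨ ∑-+ V _ _ ⟩
      ∑ V (λ x → E * (⟦ C x ⟧ * #indep k (C ∩apart x))) + ∑ V (λ x → m ^ k * ⟦ bad C x ⟧)
                                                    ≡⟨ cong₂ _+_ (∑-*ˡ V E _) (∑-*ˡ V (m ^ k) _) ⟩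
      E * ∑ V (λ x → ⟦ C x ⟧ * #indep k (C ∩apart x)) + m ^ k * # (bad C)
                                                    ≡⟨ cong (λ z → E * z + m ^ k * # (bad C)) unfold ⟨
      E * I + m ^ k * # (bad C)                     ∎
      where
      unfold : I ≡ ∑ V (λ x → ⟦ C x ⟧ * #indep k (C ∩apart x))
      unfold = trans (∑-tuples V k _) (∑-cong V λ x →
        trans (∑-cong (tuples V k) λ v → ⟦∧⟧ (C x) _) (∑-*ˡ (tuples V k) ⟦ C x ⟧ _))

  indep⇒all : ∀ {k} C (v : Vec (Fin n) k) → indep C v ≡ true → all C v ≡ true
  indep⇒all C v eq = weaken C v (λ _ c → c) eq
    where
    weaken : ∀ {k} D (v : Vec (Fin n) k) → (∀ x → D x ≡ true → C x ≡ true) → indep D v ≡ true → all C v ≡ true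
    weaken D []      D⊆C eq = refl
    weaken D (x ∷ v) D⊆C eq = ∧-true (D⊆C x (∧-trueˡ eq))
      (weaken (D ∩apart x) v (λ w d → D⊆C w (∧-trueˡ d)) (∧-trueʳ {D x} eq))

  indep⇒∈ : ∀ {k} C (v : Vec (Fin n) k) → indep C v ≡ true → ∀ i → C (lookup v i) ≡ true
  indep⇒∈ C (x ∷ v) eq zero    = ∧-trueˡ eq
  indep⇒∈ C (x ∷ v) eq (suc i) = ∧-trueˡ (indep⇒∈ (C ∩apart x) v (∧-trueʳ {C x} eq) i)

  indep⇒apart : ∀ {k} C (v : Vec (Fin n) k) → indep C v ≡ true → Apart (lookup v)
  indep⇒apart C (x ∷ v) eq zero    zero    i≢j = contradiction refl i≢j
  indep⇒apart C (x ∷ v) eq zero    (suc j) i≢j =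
    ∧-trueʳ {C (lookup v j)} (indep⇒∈ (C ∩apart x) v (∧-trueʳ {C x} eq) j)
  indep⇒apart C (x ∷ v) eq (suc i) zero    i≢j =
    apart-sym (indep⇒apart C (x ∷ v) eq zero (suc i) (λ ()))
  indep⇒apart C (x ∷ v) eq (suc i) (suc j) i≢j =
    indep⇒apart (C ∩apart x) v (∧-trueʳ {C x} eq) i j (λ i≡j → i≢j (cong suc i≡j))

  -- Realised patterns and spoiled tuples

  test : Pat → Fin n → Fin n → Bool
  test nbr x w = adj G x w
  test non x w = apart x w
  test any x w = true

  real : ∀ {k} → Vec Pat k → Vec (Fin n) k → Fin n → Bool
  real []      []      w = true
  real (p ∷ π) (x ∷ v) w = test p x w ∧ real π v w

  real⇒test : ∀ {k} (π : Vec Pat k) v {w} → real π v w ≡ true → ∀ i → test (lookup π i) (lookup v i) w ≡ true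
  real⇒test (p ∷ π) (x ∷ v) eq zero    = ∧-trueˡ eq
  real⇒test (p ∷ π) (x ∷ v) {w} eq (suc i) = real⇒test π v (∧-trueʳ {test p x w} eq) i

  common⇒real : ∀ {k} {π : Vec Pat k} → All (_≢ non) π → ∀ v {w} → common G v w ≡ true → real π v w ≡ true
  common⇒real []       []      eq = refl
  common⇒real {π = nbr ∷ _} (p≢ ∷ ps) (x ∷ v) {w} eq = ∧-true (∧-trueˡ eq) (common⇒real ps v (∧-trueʳ {adj G x w} eq))
  common⇒real {π = any ∷ _} (p≢ ∷ ps) (x ∷ v) {w} eq = common⇒real ps v (∧-trueʳ {adj G x w} eq)
  common⇒real {π = non ∷ _} (p≢ ∷ ps) (x ∷ v) eq = contradiction refl p≢

  real-insertAt : ∀ {k} (π : Vec Pat k) v i p a w →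
    real (insertAt π i p) (insertAt v i a) w ≡ test p a w ∧ real π v w
  real-insertAt π       v       zero    p a w = refl
  real-insertAt (q ∷ π) (x ∷ v) (suc i) p a w =
    trans (cong (test q x w ∧_) (real-insertAt π v i p a w)) (∧-left-comm (test q x w) (test p a w) _)

  real-removeAt : ∀ {k} (π : Vec Pat k) x i p w →
    real (insertAt π i p) x w ≡ test p (lookup x i) w ∧ real π (removeAt x i) w
  real-removeAt π x i p w =
    trans (cong (λ y → real (insertAt π i p) y w) (≡-sym (insertAt-removeAt x i)))
          (real-insertAt π (removeAt x i) i p (lookup x i) w)

  -- a as a further coordinate of v would leave too few of the vertices realising π non-adjacent to it.
  spoils : ∀ {k} → Vec Pat k → Vec (Fin n) k → Fin n → Bool
  spoils π v a = (R ^ 3 ≤ᵇ # (real π v)) ∧ bad (real π v) a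

  spoiled : ∀ {k} → Fin (suc k) → Vec Pat k → Vec (Fin n) (suc k) → Bool
  spoiled i π x = spoils π (removeAt x i) (lookup x i)

  -- The size guard in `spoils` makes the bound unconditional: when the realised set is too small
  -- for `few-bad`, no vertex counts as spoiling.
  few-spoil : ∀ {k} (π : Vec Pat k) v → # (spoils π v) ≤ R
  few-spoil π v with R ^ 3 ≤ᵇ # (real π v) in eq
  ... | true  = <⇒≤ (few-bad (real π v) (≤ᵇ⇒≤ _ _ (Equivalence.from T-≡ eq)))
  ... | false = ≤-trans (≤-reflexive (trans (∑-allFin-const n 0) (*-zeroʳ n))) z≤n

  -- The coordinates other than `i` determine the realised set, and for each choice of them in `A`
  -- at most `R` values of the remaining coordinate spoil it.
  few-spoiled : ∀ {k} A i (π : Vec Pat k) →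
    ∑ (tuples V (suc k)) (λ x → ⟦ all A x ⟧ * ⟦ spoiled i π x ⟧) ≤ R * # A ^ k
  few-spoiled {k} A i π = begin
    ∑ (tuples V (suc k)) (λ x → ⟦ all A x ⟧ * ⟦ spoiled i π x ⟧)
      ≡⟨ ∑-insertAt V i _ ⟩
    ∑ V (λ a → ∑ (tuples V k) (λ v → ⟦ all A (insertAt v i a) ⟧ * ⟦ spoiled i π (insertAt v i a) ⟧))
      ≤⟨ ∑-mono V (λ a → ∑-mono (tuples V k) (λ v → separate a v)) ⟩
    ∑ V (λ a → ∑ (tuples V k) (λ v → ⟦ all A v ⟧ * ⟦ spoils π v a ⟧))
      ≡⟨ ∑-swap V (tuples V k) _ ⟩
    ∑ (tuples V k) (λ v → ∑ V (λ a → ⟦ all A v ⟧ * ⟦ spoils π v a ⟧))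
      ≡⟨ ∑-cong (tuples V k) (λ v → ∑-*ˡ V ⟦ all A v ⟧ _) ⟩
    ∑ (tuples V k) (λ v → ⟦ all A v ⟧ * # (spoils π v))
      ≤⟨ ∑-mono (tuples V k) (λ v → *-monoʳ-≤ ⟦ all A v ⟧ (few-spoil π v)) ⟩
    ∑ (tuples V k) (λ v → ⟦ all A v ⟧ * R)
      ≡⟨ trans (∑-*ʳ (tuples V k) R _) (trans (cong (_* R) (∑-all V A k)) (*-comm _ R)) ⟩
    R * # A ^ k ∎
    where
    separate : ∀ a v → ⟦ all A (insertAt v i a) ⟧ * ⟦ spoiled i π (insertAt v i a) ⟧ ≤ ⟦ all A v ⟧ * ⟦ spoils π v a ⟧
    separate a v rewrite all-insertAt A v i a | removeAt-insertAt v i a | insertAt-lookup v i a =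
      *-monoˡ-≤ ⟦ spoils π v a ⟧ (⟦⟧-mono {A a ∧ all A v} (∧-trueʳ {A a}))

  #spoiled : ∀ {k} → Vec (Fin n) (suc k) → ℕ
  #spoiled {k} x = ∑ (allFin (suc k)) (λ i → ∑ (tuples pats k) (λ π → ⟦ spoiled i π x ⟧))

  ∑-spoiled : ∀ k A →
    ∑ (tuples V (suc k)) (λ x → ⟦ all A x ⟧ * #spoiled x) ≤ suc k * 3 ^ k * (R * # A ^ k)
  ∑-spoiled k A = begin
    ∑ U (λ x → ⟦ all A x ⟧ * #spoiled x)
      ≡⟨ ∑-cong U (λ x → trans (≡-sym (∑-*ˡ I ⟦ all A x ⟧ _)) (∑-cong I λ i → ≡-sym (∑-*ˡ P ⟦ all A x ⟧ _))) ⟩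
    ∑ U (λ x → ∑ I (λ i → ∑ P (λ π → ⟦ all A x ⟧ * ⟦ spoiled i π x ⟧)))
      ≡⟨ trans (∑-swap U I _) (∑-cong I λ i → ∑-swap U P _) ⟩
    ∑ I (λ i → ∑ P (λ π → ∑ U (λ x → ⟦ all A x ⟧ * ⟦ spoiled i π x ⟧)))
      ≤⟨ ∑-mono I (λ i → ∑-mono P (λ π → few-spoiled A i π)) ⟩
    ∑ I (λ i → ∑ P (λ π → R * # A ^ k))
      ≡⟨ ∑-cong I (λ i → trans (∑-const P _) (cong (_* (R * # A ^ k)) (length-tuples pats k))) ⟩
    ∑ I (λ i → 3 ^ k * (R * # A ^ k))
      ≡⟨ trans (∑-allFin-const (suc k) _) (≡-sym (*-assoc (suc k) (3 ^ k) _)) ⟩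
    suc k * 3 ^ k * (R * # A ^ k) ∎
    where
    U : List (Vec (Fin n) (suc k))
    U = tuples V (suc k)
    I : List (Fin (suc k))
    I = allFin (suc k)
    P : List (Vec Pat k)
    P = tuples pats k

  Unspoiled : ∀ {k} → Vec (Fin n) (suc k) → Set
  Unspoiled {k} x = ∀ i (π : Vec Pat k) → spoiled i π x ≡ false

  -- With `m` the size of `A`, the union bound over positions and patterns counts at most
  -- `R ^ 2 * m ^ k` spoilings, while there are at least `m ^ suc k / R ^ (suc k * suc k)`
  -- independent tuples, which is more.
  unspoiled-indep : ∀ k A → suc k * 3 ^ k ≤ R → R ^ (3 + (suc k * suc k + suc k * 2)) ≤ # A →
    ∃ λ x → indep A x ≡ true × Unspoiled {k} x
  unspoiled-indep k A cst≤R large = let (x , lt) = ∑-<⇒∃< (tuples V (suc k)) spoiled<indep in x , conclude x lt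
    where
    m e : ℕ
    m = # A
    e = suc k * suc k
    instance
      m≢0 : NonZero m
      m≢0 = >-nonZero (≤-trans (m^n>0 R (3 + (e + suc k * 2))) large)
      mᵏ≢0 : NonZero (m ^ k)
      mᵏ≢0 = m^n≢0 m k
    spoiled<indep : ∑ (tuples V (suc k)) (λ x → ⟦ all A x ⟧ * #spoiled x) < #indep (suc k) A
    spoiled<indep = *-cancelˡ-< (R ^ e) _ _ (begin-strict
      R ^ e * ∑ (tuples V (suc k)) (λ x → ⟦ all A x ⟧ * #spoiled x)
                                          ≤⟨ *-monoʳ-≤ (R ^ e) (∑-spoiled k A) ⟩
      R ^ e * (suc k * 3 ^ k * (R * m ^ k)) ≤⟨ *-monoʳ-≤ (R ^ e) (*-monoˡ-≤ (R * m ^ k) cst≤R) ⟩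
      R ^ e * (R * (R * m ^ k))           ≡⟨ regroup R (R ^ e) (m ^ k) ⟩
      R ^ (2 + e) * m ^ k                 <⟨ *-monoˡ-< (m ^ k) (<-≤-trans (^-monoʳ-< R 1<R {2 + e} {3 + e} ≤-refl)
                                               (≤-trans (^-monoʳ-≤ R (+-monoʳ-≤ 3 (m≤m+n e (suc k * 2)))) large)) ⟩
      m ^ suc k                           ≤⟨ many-indep (suc k) A (≤-trans (^-monoʳ-≤ R (+-monoʳ-≤ 3 (m≤n+m (suc k * 2) e))) large) ⟩
      R ^ e * #indep (suc k) A            ∎)
      where
      regroup : ∀ r a b → a * (r * (r * b)) ≡ r * (r * a) * b
      regroup = solve-∀
    conclude : ∀ x → ⟦ all A x ⟧ * #spoiled x < ⟦ indep A x ⟧ → indep A x ≡ true × Unspoiled x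
    -- The right-hand indicator is at most 1, so strictness forces it to be 1 and the spoiling count
    -- to be 0.
    conclude x lt = ind , λ i π → ⟦⟧<1 (≤-<-trans
        (≤-trans (term≤∑ (λ π → ⟦ spoiled i π x ⟧) (∈-tuples ∈-pats π))
                 (term≤∑ (λ i → ∑ (tuples pats k) (λ π → ⟦ spoiled i π x ⟧)) (∈-allFin i)))
        #spoiled<1)
      where
      ind : indep A x ≡ true
      ind = 0<⟦⟧ (≤-<-trans z≤n lt)
      #spoiled<1 : #spoiled x < 1
      #spoiled<1 = begin-strict
        #spoiled x                   ≡⟨ *-identityˡ _ ⟨
        1 * #spoiled x               ≡⟨ cong (λ b → ⟦ b ⟧ * #spoiled x) (indep⇒all A x ind) ⟨
        ⟦ all A x ⟧ * #spoiled x     <⟨ lt ⟩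
        ⟦ indep A x ⟧                ≤⟨ ⟦⟧≤1 _ ⟩
        1                            ∎

  -- Induction along `Rank`: turning `any` into `non` at `i` restricts a set determined by the other
  -- entries to the vertices apart from the entry at `i`, which is not bad for it. `b` is the budget
  -- left for later restrictions and rises by 2 in the recursive call.
  real-large : ∀ {k} {x : Vec (Fin n) (suc k)} → Unspoiled x → ∀ {π c b} → Rank π c →
    R ^ (3 + (c * 2 + b)) ≤ # (common G x) → R ^ (3 + b) ≤ # (real π x)
  real-large {x = x} ok (base ps) le = ≤-trans le (∑-mono V λ w → ⟦⟧-mono (common⇒real ps x))
  real-large {x = x} ok {b = b} (step {π = π} i {c} r) le =
    ≤-trans (still-large {a = 3 + b} not-bad W-large) (≤-reflexive (∑-cong V λ w →
      cong ⟦_⟧ (trans (∧-comm (W w) _) (≡-sym (real-removeAt π x i non w)))))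
    where
    W : Fin n → Bool
    W = real π (removeAt x i)
    move : ∀ c b → 3 + (2 + c * 2 + b) ≡ 3 + (c * 2 + (2 + b))
    move = solve-∀
    W-large : R ^ (2 + (3 + b)) ≤ # W
    W-large = ≤-trans (real-large ok {b = 2 + b} r (subst (λ e → R ^ e ≤ # (common G x)) (move c b) le))
      (≤-reflexive (∑-cong V λ w → cong ⟦_⟧ (real-removeAt π x i any w)))
    -- `W` is large enough to pass the size guard in `spoils`, so being unspoiled says exactly that
    -- the entry is not bad.
    not-bad : bad W (lookup x i) ≡ false
    not-bad = trans (cong (_∧ bad W (lookup x i)) (≡-sym (Equivalence.to T-≡ (≤⇒≤ᵇ
      (≤-trans (^-monoʳ-≤ R (m≤m+n 3 (2 + b))) W-large))))) (ok i π)

  -- Independent transversals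

  Transversal : ∀ {k} → (Fin k → Fin n → Bool) → Set
  Transversal {k} W = Σ (Fin k → Fin n) λ w → (∀ i → W i (w i) ≡ true) × Apart w

  prepend : ∀ {k} (W : Fin (suc k) → Fin n → Bool) w₀ → W zero w₀ ≡ true →
    Transversal (λ i → W (suc i) ∩apart w₀) → Transversal W
  prepend {k} W w₀ w₀∈W (w , w∈W , w-apart) = w′ , w′∈W , w′-apart
    where
    w′ : Fin (suc k) → Fin n
    w′ zero    = w₀
    w′ (suc i) = w i
    w′∈W : ∀ i → W i (w′ i) ≡ true
    w′∈W zero    = w₀∈W
    w′∈W (suc i) = ∧-trueˡ (w∈W i)
    w₀-apart : ∀ i → apart w₀ (w i) ≡ true
    w₀-apart i = ∧-trueʳ {W (suc i) (w i)} (w∈W i)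
    w′-apart : Apart w′
    w′-apart zero    zero    i≢j = contradiction refl i≢j
    w′-apart zero    (suc j) i≢j = w₀-apart j
    w′-apart (suc i) zero    i≢j = apart-sym (w₀-apart i)
    w′-apart (suc i) (suc j) i≢j = w-apart i j (λ i≡j → i≢j (cong suc i≡j))

  -- At most `k * R ≤ R ^ 2` vertices are bad for some later set, fewer than the first set contains.
  good-first-vertex : ∀ k (W : Fin (suc k) → Fin n → Bool) → k ≤ R → (∀ i → R ^ 3 < # (W i)) →
    ∃ λ w₀ → W zero w₀ ≡ true × (∀ i → bad (W (suc i)) w₀ ≡ false)
  good-first-vertex k W k≤R large = conclude (∑-<⇒∃< V few-excluded)
    where
    excluded : Fin n → ℕ
    excluded w = ∑ (allFin k) (λ i → ⟦ bad (W (suc i)) w ⟧)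
    few-excluded : ∑ V excluded < # (W zero)
    few-excluded = begin-strict
      ∑ V excluded                                  ≡⟨ ∑-swap V (allFin k) _ ⟩
      ∑ (allFin k) (λ i → # (bad (W (suc i))))      ≤⟨ ∑-mono (allFin k) (λ i → <⇒≤ (few-bad (W (suc i)) (<⇒≤ (large (suc i))))) ⟩
      ∑ (allFin k) (λ _ → R)                        ≡⟨ ∑-allFin-const k R ⟩
      k * R                                         ≤⟨ *-monoˡ-≤ R k≤R ⟩
      R * R                                         ≡⟨ cong (R *_) (*-identityʳ R) ⟨
      R ^ 2                                         ≤⟨ ^-monoʳ-≤ R (n≤1+n 2) ⟩
      R ^ 3                                         <⟨ large zero ⟩
      # (W zero)                                    ∎
    conclude : (∃ λ w₀ → excluded w₀ < ⟦ W zero w₀ ⟧) →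
      ∃ λ w₀ → W zero w₀ ≡ true × (∀ i → bad (W (suc i)) w₀ ≡ false)
    conclude (w₀ , lt) = w₀ , 0<⟦⟧ (≤-<-trans z≤n lt) , λ i →
      ⟦⟧<1 {bad (W (suc i)) w₀} (≤-<-trans (term≤∑ (λ i → ⟦ bad (W (suc i)) w₀ ⟧) (∈-allFin i))
        (<-≤-trans lt (⟦⟧≤1 (W zero w₀))))

  -- Greedy choice: pick a vertex of the first set that is bad for none of the others, then restrict
  -- those to its non-neighbours. The sets may overlap, since `apart` enforces distinctness.
  transversal : ∀ k (W : Fin k → Fin n → Bool) → k ≤ R → (∀ i → R ^ (3 + k * 2) ≤ # (W i)) → Transversal W
  transversal zero    W k≤R large = (λ ()) , (λ ()) , (λ ())
  transversal (suc k) W k<R large = conclude (good-first-vertex k W (<⇒≤ k<R) λ i →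
      <-≤-trans (^-monoʳ-< R 1<R {3} {3 + suc k * 2} (s≤s (s≤s (s≤s (s≤s z≤n))))) (large i))
    where
    conclude : (∃ λ w₀ → W zero w₀ ≡ true × (∀ i → bad (W (suc i)) w₀ ≡ false)) → Transversal W
    conclude (w₀ , w₀∈W , not-bad) = prepend W w₀ w₀∈W
      (transversal k (λ i → W (suc i) ∩apart w₀) (<⇒≤ k<R)
        (λ i → still-large {a = 3 + k * 2} (not-bad i) (large (suc i))))

  -- Assembling the induced copy

  pattern-of : ∀ {h} → Graph h → Fin h → Fin h → Pat
  pattern-of H j i = if adj H i j then nbr else non

  -- Both families are indexed by all vertices of `H`, and the colour decides which of the two
  -- candidates is used; the colour classes are never enumerated. Within a class neither graph has
  -- edges, and across classes `matches` fixes adjacency.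
  assemble : ∀ {h} (H : Graph h) → IsBipartite H → (x w : Fin h → Fin n) → Apart x → Apart w →
    (∀ i j → test (pattern-of H j i) (x i) (w j) ≡ true) → ContainsInduced H G
  assemble {h} H (col , proper) x w x-apart w-apart matches = φ , φ-inj , φ-adj
    where
    cross-adj : ∀ i j → adj G (x i) (w j) ≡ adj H i j
    cross-adj i j with adj H i j | matches i j
    ... | true  | eq = eq
    ... | false | eq = apart⇒¬adj eq
    cross-≢ : ∀ i j → x i ≢ w j
    cross-≢ i j with adj H i j | matches i j
    ... | true  | eq = adj⇒≢ eq
    ... | false | eq = apart⇒≢ eq
    monochromatic : ∀ u v → col u ≡ col v → adj H u v ≡ false
    monochromatic u v cu≡cv with adj H u v in eq
    ... | false = refl
    ... | true  = contradiction cu≡cv (proper u v eq)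
    side-adj : ∀ (y : Fin h → Fin n) → Apart y → ∀ u v → adj G (y u) (y v) ≡ false
    side-adj y y-apart u v with u ≟ v
    ... | yes refl = irrefl G (y u)
    ... | no u≢v   = apart⇒¬adj (y-apart u v u≢v)
    side-inj : ∀ (y : Fin h → Fin n) → Apart y → ∀ u v → y u ≡ y v → u ≡ v
    side-inj y y-apart u v eq with u ≟ v
    ... | yes u≡v = u≡v
    ... | no u≢v  = contradiction eq (apart⇒≢ (y-apart u v u≢v))
    φ : Fin h → Fin n
    φ v = if col v then x v else w v
    φ-inj : ∀ u v → φ u ≡ φ v → u ≡ v
    φ-inj u v eq with col u | col v
    ... | true  | true  = side-inj x x-apart u v eq
    ... | true  | false = contradiction eq (cross-≢ u v)
    ... | false | true  = contradiction (≡-sym eq) (cross-≢ v u)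
    ... | false | false = side-inj w w-apart u v eq
    φ-adj : ∀ u v → adj G (φ u) (φ v) ≡ adj H u v
    φ-adj u v with col u in cu | col v in cv
    ... | true  | true  = trans (side-adj x x-apart u v) (≡-sym (monochromatic u v (trans cu (≡-sym cv))))
    ... | true  | false = cross-adj u v
    ... | false | true  = trans (sym G (w u) (x v)) (trans (cross-adj v u) (sym H v u))
    ... | false | false = trans (side-adj w w-apart u v) (≡-sym (monochromatic u v (trans cu (≡-sym cv))))

  induced-copy : ∀ {k} (H : Graph (suc k)) → IsBipartite H → suc k ≤ R → suc k * 3 ^ k ≤ R → ∀ A →
    R ^ (3 + (suc k * suc k + suc k * 2)) ≤ # A →
    (∀ (x : Vec (Fin n) (suc k)) → all A x ≡ true → R ^ (3 + (suc k * 2 + suc k * 2)) ≤ # (common G x)) →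
    ContainsInduced H G
  induced-copy {k} H bip h≤R cst≤R A A-large rich = conclude (unspoiled-indep k A cst≤R A-large)
    where
    π : Fin (suc k) → Vec Pat (suc k)
    π j = Vec.tabulate (pattern-of H j)
    conclude : (∃ λ x → indep A x ≡ true × Unspoiled {k} x) → ContainsInduced H G
    conclude (x , x-indep , ok) = finish (transversal (suc k) W h≤R W-large)
      where
      W : Fin (suc k) → Fin n → Bool
      W j = real (π j) x
      -- A pattern has at most `suc k` entries `non`, each costing `R ^ 2`; what remains is the size
      -- `transversal` asks for.
      W-large : ∀ j → R ^ (3 + suc k * 2) ≤ # (W j)
      W-large j = real-large {x = x} ok (rank (π j))
        (≤-trans (^-monoʳ-≤ R (+-monoʳ-≤ 3 (+-monoˡ-≤ (suc k * 2) (*-monoˡ-≤ 2 (nons≤ (π j))))))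
                 (rich x (indep⇒all A x x-indep)))
      finish : Transversal W → ContainsInduced H G
      finish (w , w∈W , w-apart) = assemble H bip (lookup x) w (indep⇒apart A x x-indep) w-apart λ i j →
        subst (λ p → test p (lookup x i) (w j) ≡ true) (lookup∘tabulate (pattern-of H j) i)
          (real⇒test (π j) x (w∈W j) i)

-- Choice of exponents

-- In `codegree-exponent` one `h * 2` pays for the entries `non`, the other for the transversal. In
-- `set-exponent`, `h * h` is the loss in `many-indep` and `h * 2` the shrinking of its candidate
-- set. The two summands of `size-exponent` serve `few-poor` and `room`.
codegree-exponent set-exponent size-exponent : ℕ → ℕ
codegree-exponent h = 3 + (h * 2 + h * 2)
set-exponent h = 3 + (h * h + h * 2)
size-exponent h = suc (suc (codegree-exponent h) * 2) + suc (h + h + set-exponent h)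

-- A sum, so that `constant k ≤ R` bounds 3, `suc k` and `suc k * 3 ^ k` by `R` at once.
constant : ℕ → ℕ
constant k = 3 + (suc k + suc k * 3 ^ k)

dense⇒induced-copy : ∀ {k} (H : Graph (suc k)) → IsBipartite H → ∀ {n} (G : Graph n) R →
  constant k ≤ R → R ^ size-exponent (suc k) ≤ n → 2 * (n * n) ≤ R * ∑ (allFin n) (deg G) →
  ¬ ContainsKss R G → ContainsInduced H G
dense⇒induced-copy {k} H bip {n} G R c≤R Rᵠ≤n dense free =
  -- Taking `t = k + h` means `2 * h` random vertices: of `n ^ (h + h)`, one factor `n ^ h` covers
  -- the number of tuples and the other the powers of `R`.
  let (A , A-large , rich) = dependent-random-choice G R h (k + h) (R ^ codegree-exponent h) (R ^ set-exponent h)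
                               3≤R (≤-trans (m^n>0 R (size-exponent h)) Rᵠ≤n) dense few-poor room
  in Host.induced-copy G R 3≤R free H bip (≤-trans (m≤m+n h _) (≤-trans (m≤n+m _ 3) c≤R))
       (≤-trans (m≤n+m _ h) (≤-trans (m≤n+m _ 3) c≤R)) A A-large rich
  where
  open ≤-Reasoning
  h ℓ : ℕ
  h = suc k
  ℓ = suc (codegree-exponent h)
  3≤R : 3 ≤ R
  3≤R = ≤-trans (m≤m+n 3 _) c≤R
  instance
    R≢0 : NonZero R
    R≢0 = >-nonZero (≤-trans (s≤s z≤n) 3≤R)
  room : R * (R ^ (h + h) * R ^ set-exponent h) ≤ n
  room = begin
    R * (R ^ (h + h) * R ^ set-exponent h)    ≡⟨ cong (R *_) (^-distribˡ-+-* R (h + h) (set-exponent h)) ⟨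
    R ^ suc (h + h + set-exponent h)          ≤⟨ ^-monoʳ-≤ R (m≤n+m _ (suc (ℓ * 2))) ⟩
    R ^ size-exponent h                       ≤⟨ Rᵠ≤n ⟩
    n                                         ∎
  few-poor : R * (n * n ^ h * (R * R ^ codegree-exponent h) ^ (h + h)) ≤ n * n ^ (h + h)
  few-poor = begin
    R * (n * n ^ h * (R ^ ℓ) ^ (h + h))       ≡⟨ cong (λ z → R * (n * n ^ h * z)) (^-*-assoc R ℓ (h + h)) ⟩
    R * (n * n ^ h * R ^ (ℓ * (h + h)))       ≡⟨ regroup R n (n ^ h) (R ^ (ℓ * (h + h))) ⟩
    n * (n ^ h * R ^ suc (ℓ * (h + h)))       ≤⟨ *-monoʳ-≤ n (*-monoʳ-≤ (n ^ h) (^-monoʳ-≤ R exponents)) ⟩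
    n * (n ^ h * R ^ (suc (ℓ * 2) * h))       ≡⟨ cong (λ z → n * (n ^ h * z)) (^-*-assoc R (suc (ℓ * 2)) h) ⟨
    n * (n ^ h * (R ^ suc (ℓ * 2)) ^ h)       ≤⟨ *-monoʳ-≤ n (*-monoʳ-≤ (n ^ h) (^-monoˡ-≤ h
                                                   (≤-trans (^-monoʳ-≤ R (m≤m+n (suc (ℓ * 2)) _)) Rᵠ≤n))) ⟩
    n * (n ^ h * n ^ h)                       ≡⟨ cong (n *_) (^-distribˡ-+-* n h h) ⟨
    n * n ^ (h + h)                           ∎
    where
    regroup : ∀ r n a b → r * (n * a * b) ≡ n * (a * (r * b))
    regroup = solve-∀
    split : ∀ l h → l * (h + h) ≡ l * 2 * h
    split = solve-∀
    exponents : suc (ℓ * (h + h)) ≤ suc (ℓ * 2) * h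
    exponents = +-mono-≤ {1} {h} (s≤s z≤n) (≤-reflexive (split ℓ h))

-- From a violated bound to the parameters

-- `suc r` is the `q`-th root of `n` rounded up. Raising `n` by one raises `r` by at most one.
root : ∀ q n → 1 ≤ q → 1 ≤ n → ∃ λ r → r ^ q < n × n ≤ suc r ^ q
root (suc q) (suc zero)    _ _ = 0 , s≤s z≤n , m^n>0 1 (suc q)
root (suc q) (suc (suc n)) _ _ with root (suc q) (suc n) (s≤s z≤n) (s≤s z≤n)
... | r , lower , upper with suc (suc n) ≤? suc r ^ suc q
...   | yes le = r , m<n⇒m<1+n lower , le
...   | no  ¬le = suc r , ≰⇒> ¬le , ≤-<-trans upper (^-monoˡ-< (suc q) (n<1+n (suc r)))

edges≤∑deg : ∀ {n} (G : Graph n) → edges G ≤ ∑ (allFin n) (deg G)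
edges≤∑deg {n} G = ∑-mono (allFin n) λ i → ∑-mono (allFin n) λ j → ⟦⟧-mono {(toℕ j <ᵇ toℕ i) ∧ adj G i j} (∧-trueʳ {toℕ j <ᵇ toℕ i})

∑deg≤n² : ∀ {n} (G : Graph n) → ∑ (allFin n) (deg G) ≤ n * n
∑deg≤n² {n} G = ≤-trans (∑-mono (allFin n) λ i → #≤n (adj G i)) (≤-reflexive (∑-allFin-const n n))

Kss-mono : ∀ {n s t} {G : Graph n} → s ≤ t → ContainsKss t G → ContainsKss s G
Kss-mono s≤t (f , g , f-inj , g-inj , f≢g , fg) =
  f ∘ ι , g ∘ ι , (λ i j eq → ι-inj i j (f-inj _ _ eq)) , (λ i j eq → ι-inj i j (g-inj _ _ eq))
  , (λ i j → f≢g (ι i) (ι j)) , λ i j → fg (ι i) (ι j)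
  where
  ι = λ i → inject≤ i s≤t
  ι-inj : ∀ i j → ι i ≡ ι j → i ≡ j
  ι-inj i j = inject≤-injective s≤t s≤t i j

^-cancelʳ-< : ∀ q a b → a ^ q < b ^ q → a < b
^-cancelʳ-< q a b lt = ≰⇒> λ b≤a → <⇒≱ lt (^-monoˡ-≤ q b≤a)

m≤m⁴ : ∀ m → 1 ≤ m → m ≤ m ^ 4
m≤m⁴ (suc m) _ = ≤-trans (≤-reflexive (≡-sym (*-identityʳ (suc m)))) (*-monoʳ-≤ (suc m) (m^n>0 (suc m) 3))

-- The number R = suc r with r ^ q < n ≤ R ^ q plays the role of n ^ (1 / q).
violation⇒parameters : ∀ q′ c s n e → 1 ≤ q′ → 3 ≤ c → 1 ≤ s → 1 ≤ n → e ≤ n * n →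
  c ^ (2 * q′) * s ^ (4 * (2 * q′)) * n ^ (2 * (2 * q′) ∸ 1) < e ^ (2 * q′) →
  ∃ λ R → c ≤ R × s ≤ R × R ^ q′ ≤ n × 2 * (n * n) ≤ R * e
violation⇒parameters q′ c s n e 1≤q′ 3≤c 1≤s 1≤n e≤n² violated
  with root (2 * q′) n (≤-trans 1≤q′ (m≤m+n q′ _)) 1≤n
... | r , rᵠ<n , n≤Rᵠ = R , <⇒≤ c<R , s≤R , Rᵠ′≤n , dense
  where
  open ≤-Reasoning
  q R P : ℕ
  q = 2 * q′
  R = suc r
  P = n ^ (2 * q ∸ 1)
  instance
    n≢0 : NonZero n
    n≢0 = >-nonZero 1≤n
    s≢0 : NonZero s
    s≢0 = >-nonZero 1≤s
    c≢0 : NonZero c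
    c≢0 = >-nonZero (≤-trans (s≤s z≤n) 3≤c)
  nP : (n * n) ^ q ≡ n * P
  nP = begin-equality
    (n * n) ^ q       ≡⟨ cong (λ z → (n * z) ^ q) (*-identityʳ n) ⟨
    (n ^ 2) ^ q       ≡⟨ ^-*-assoc n 2 q ⟩
    n ^ (2 * q)       ≡⟨ cong (n ^_) (m+[n∸m]≡n {1} {2 * q} (≤-trans 1≤q′ (≤-trans (m≤m+n q′ _) (m≤m+n q _)))) ⟨
    n * P             ∎
  cs⁴-violated : (c * s ^ 4) ^ q * P < e ^ q
  cs⁴-violated = ≤-<-trans (≤-reflexive (cong (_* P) (trans (^-distribʳ-* c (s ^ 4) q) (cong (c ^ q *_) (^-*-assoc s 4 q))))) violated
  -- As `e ≤ n * n`, cancelling `P` from the violated bound leaves `(c * s ^ 4) ^ q < n ≤ R ^ q`;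
  -- this puts both `c` and `s` below `R`.
  cs⁴<R : c * s ^ 4 < R
  cs⁴<R = ^-cancelʳ-< q _ _ (<-≤-trans (*-cancelʳ-< P _ _
    (<-≤-trans cs⁴-violated (≤-trans (^-monoˡ-≤ q e≤n²) (≤-reflexive nP)))) n≤Rᵠ)
  c≤cs⁴ : c ≤ c * s ^ 4
  c≤cs⁴ = m≤m*n c (s ^ 4) {{m^n≢0 s 4}}
  c<R : c < R
  c<R = ≤-<-trans c≤cs⁴ cs⁴<R
  s≤R : s ≤ R
  s≤R = ≤-trans (m≤m⁴ s 1≤s) (≤-trans (m≤n*m (s ^ 4) c) (<⇒≤ cs⁴<R))
  -- Rounding up may push `R ^ q` beyond `n`; halving the exponent repairs this, since `R ≤ r ^ 2`.
  Rᵠ′≤n : R ^ q′ ≤ n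
  Rᵠ′≤n = begin
    R ^ q′          ≤⟨ ^-monoˡ-≤ q′ R≤r² ⟩
    (r ^ 2) ^ q′    ≡⟨ ^-*-assoc r 2 q′ ⟩
    r ^ q           ≤⟨ <⇒≤ rᵠ<n ⟩
    n               ∎
    where
    2≤r : 2 ≤ r
    2≤r = s≤s⁻¹ (≤-trans 3≤c (<⇒≤ c<R))
    R≤r² : R ≤ r ^ 2
    R≤r² = begin
      1 + r       ≤⟨ +-monoˡ-≤ r (<⇒≤ 2≤r) ⟩
      r + r       ≡⟨ double r ⟩
      2 * r       ≤⟨ *-monoˡ-≤ r 2≤r ⟩
      r * r       ≡⟨ cong (r *_) (*-identityʳ r) ⟨
      r ^ 2       ∎
      where
      double : ∀ r → r + r ≡ 2 * r
      double = solve-∀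
  -- Multiplying the violated bound by `n ≤ R ^ q` and taking `q`-th roots gives
  -- `c * (n * n) < R * e`, and `2 ≤ c`.
  dense : 2 * (n * n) ≤ R * e
  dense = ≤-trans (*-monoˡ-≤ (n * n) (≤-trans (n≤1+n 2) 3≤c)) (<⇒≤ (^-cancelʳ-< q _ _ (begin-strict
    (c * (n * n)) ^ q           ≡⟨ ^-distribʳ-* c (n * n) q ⟩
    c ^ q * (n * n) ^ q         ≡⟨ cong (c ^ q *_) nP ⟩
    c ^ q * (n * P)             ≡⟨ regroup (c ^ q) n P ⟩
    n * (c ^ q * P)             ≤⟨ *-monoʳ-≤ n (*-monoˡ-≤ P (^-monoˡ-≤ q c≤cs⁴)) ⟩
    n * ((c * s ^ 4) ^ q * P)   <⟨ *-monoʳ-< n cs⁴-violated ⟩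
    n * e ^ q                   ≤⟨ *-monoˡ-≤ (e ^ q) n≤Rᵠ ⟩
    R ^ q * e ^ q               ≡⟨ ^-distribʳ-* R e q ⟨
    (R * e) ^ q                 ∎)))
    where
    regroup : ∀ a n p → a * (n * p) ≡ n * (a * p)
    regroup = solve-∀

-- The exponent `ε_H` is the fraction `p / q`, and the bound is raised to the power `q` so that it
-- can be stated in natural numbers.
theorem1p4 : ∀ {h} (H : Graph h) → IsBipartite H →
    Σ ℕ λ p → Σ ℕ λ q → Σ ℕ λ c →
    0 < p × 2 * p ≤ q × 1 < c ×
    (∀ (s n : ℕ) → 1 ≤ s → 1 ≤ n → (G : Graph n) →
    ¬ ContainsKss s G → ¬ ContainsInduced H G →
    edges G ^ q ≤ c ^ q * s ^ (4 * q) * n ^ (2 * q ∸ p))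
-- If `H` has no vertices, the empty map is an induced copy and no admissible `G` exists; the values
-- 1, 2, 2 only meet the side conditions.
theorem1p4 {zero} H bip = 1 , 2 , 2 , ≤-refl , ≤-refl , ≤-refl , λ s n 1≤s 1≤n G Kss-free H-free →
  contradiction ((λ ()) , (λ ()) , λ ()) H-free
theorem1p4 {suc k} H bip =
  -- `q′` is the power of `R` that must fit below `n`; doubling it covers the rounding of the root
  -- and gives `ε_H ≤ 1 / 2`.
  1 , 2 * q′ , constant k , ≤-refl , *-monoʳ-≤ 2 {1} {q′} (s≤s z≤n) , s≤s (s≤s z≤n) , bound
  where
  q′ : ℕ
  q′ = size-exponent (suc k)
  bound : ∀ (s n : ℕ) → 1 ≤ s → 1 ≤ n → (G : Graph n) → ¬ ContainsKss s G → ¬ ContainsInduced H G →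
    edges G ^ (2 * q′) ≤ constant k ^ (2 * q′) * s ^ (4 * (2 * q′)) * n ^ (2 * (2 * q′) ∸ 1)
  bound s n 1≤s 1≤n G Kss-free H-free = ≮⇒≥ λ violated →
    let (R , c≤R , s≤R , Rᵠ≤n , dense) = violation⇒parameters q′ (constant k) s n (edges G) (s≤s z≤n)
          (m≤m+n 3 _) 1≤s 1≤n (≤-trans (edges≤∑deg G) (∑deg≤n² G)) violated
    in H-free (dense⇒induced-copy H bip G R c≤R Rᵠ≤n (≤-trans dense (*-monoʳ-≤ R (edges≤∑deg G)))
                 (λ K → Kss-free (Kss-mono {G = G} s≤R K)))
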